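{- Let $\lambda\in\mathbb{R}$, let $n$ be a positive integer and let $k$ be a positive integer. Then \[ S_{k,\lambda}(n)=\frac{n\,(n+1)_{k,\lambda}}{k+1}-\frac{1}{k+1}\sum_{r=1}^{k-1}(1)_{k+1-r,\lambda}\binom{k}{r-1}S_{r,\lambda}(n)-\frac{\lambda}{k+1}\sum_{r=1}^{k-1}r\binom{k}{r}(1)_{k-r,\lambda}\,S_{r,\lambda}(n). \]
   Context: For $\lambda\in\mathbb{R}$ the degenerate falling factorials are $(x)_{0,\lambda}=1$ and $(x)_{m,\lambda}=x(x-\lambda)(x-2\lambda)\cdots(x-(m-1)\lambda)$ for $m\ge 1$. For positive integers $r,n$, $S_{r,\lambda}(n)=\sum_{j=1}^{n}(j)_{r,\lambda}=(1)_{r,\lambda}+(2)_{r,\lambda}+\cdots+(n)_{r,\lambda}$. -}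

module Defs where

open import Level using (0ℓ)
open import Data.Nat.Base as ℕ using (ℕ; zero; suc; NonZero)
import Data.Nat.Properties as ℕ
open import Data.Integer.Base using (+_)
open import Data.Rational.Base as ℚ using (ℚ; 0ℚ; 1ℚ; ½; ∣_∣; Positive; positive)
import Data.Rational.Properties as ℚ
import Data.Rational.Unnormalised.Base as ℚᵘ
import Data.Rational.Unnormalised.Properties as ℚᵘ
open import Data.Rational.Solver using (module +-*-Solver)
open import Data.Product.Base using (∃; _×_; _,_)
open import Algebra.Bundles using (CommutativeRing)
import Algebra.Consequences.Setoid as Consequences
open import Relation.Binary.Bundles using (Setoid)
open import Relation.Binary.PropositionalEquality
  using (_≡_; refl; sym; trans; cong; subst)

-- agda-stdlib has no real numbers; these are the Cauchy reals.  A real is a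
-- rational sequence with a proof that it is Cauchy, and equality of reals is
-- the relation _≃_ ("the difference tends to 0"), not _≡_.

IsCauchy : (ℕ → ℚ) → Set
IsCauchy x = ∀ ε → 0ℚ ℚ.< ε →
  ∃ λ N → ∀ m n → N ℕ.≤ m → N ℕ.≤ n → ∣ x m ℚ.- x n ∣ ℚ.< ε

record ℝ : Set where
  constructor mkℝ
  field
    seq    : ℕ → ℚ
    cauchy : IsCauchy seq

open ℝ public

infix 4 _≃_

record _≃_ (x y : ℝ) : Set where
  constructor mk≃
  field
    close : ∀ ε → 0ℚ ℚ.< ε →
      ∃ λ N → ∀ n → N ℕ.≤ n → ∣ seq x n ℚ.- seq y n ∣ ℚ.< ε

open _≃_ public

private
  open +-*-Solver using (solve; _:+_; _:*_; _:-_; :-_; _:=_)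
  open ℚ.≤-Reasoning

  ∣∣-sym : ∀ p q → ∣ p ℚ.- q ∣ ≡ ∣ q ℚ.- p ∣
  ∣∣-sym p q = trans (sym (ℚ.∣-p∣≡∣p∣ (p ℚ.- q)))
    (cong ∣_∣ (solve 2 (λ a b → :- (a :- b) := b :- a) refl p q))

  ∣0∣<ε : ∀ {p ε} → p ≡ 0ℚ → 0ℚ ℚ.< ε → ∣ p ∣ ℚ.< ε
  ∣0∣<ε refl ε>0 = ε>0

  abstract
    half : ℚ → ℚ
    half ε = ½ ℚ.* ε

    half>0 : ∀ {ε} → 0ℚ ℚ.< ε → 0ℚ ℚ.< half ε
    half>0 {ε} ε>0 = ℚ.positive⁻¹ (½ ℚ.* ε) {{ℚ.pos*pos⇒pos ½ ε {{positive ε>0}}}}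

    sum< : ∀ {ε} r p q → r ≡ p ℚ.+ q →
           ∣ p ∣ ℚ.< half ε → ∣ q ∣ ℚ.< half ε → ∣ r ∣ ℚ.< ε
    sum< {ε} r p q refl p< q< = begin-strict
      ∣ p ℚ.+ q ∣             ≤⟨ ℚ.∣p+q∣≤∣p∣+∣q∣ p q ⟩
      ∣ p ∣ ℚ.+ ∣ q ∣         <⟨ ℚ.+-mono-< p< q< ⟩
      half ε ℚ.+ half ε       ≡⟨ sym (ℚ.*-distribʳ-+ ε ½ ½) ⟩
      1ℚ ℚ.* ε                ≡⟨ ℚ.*-identityˡ ε ⟩
      ε                       ∎

    shrink : ∀ B .{{_ : Positive B}} → ℚ → ℚ
    shrink B ε = (ℚ.1/ B) {{ℚ.pos⇒nonZero B}} ℚ.* ε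

    shrink>0 : ∀ B .{{_ : Positive B}} {ε} → 0ℚ ℚ.< ε → 0ℚ ℚ.< shrink B ε
    shrink>0 B {ε} ε>0 = ℚ.positive⁻¹ (shrink B ε)
      {{ℚ.pos*pos⇒pos ((ℚ.1/ B) {{ℚ.pos⇒nonZero B}}) {{ℚ.1/pos⇒pos B}} ε {{positive ε>0}}}}

    prod< : ∀ B .{{_ : Positive B}} {ε} a b →
            ∣ a ∣ ℚ.≤ B → ∣ b ∣ ℚ.< shrink B ε → ∣ a ℚ.* b ∣ ℚ.< ε
    prod< B {ε} a b a≤B b< = begin-strict
      ∣ a ℚ.* b ∣          ≡⟨ ℚ.∣p*q∣≡∣p∣*∣q∣ a b ⟩
      ∣ a ∣ ℚ.* ∣ b ∣      ≤⟨ ℚ.*-monoʳ-≤-nonNeg ∣ b ∣ {{ℚ.nonNegative (ℚ.0≤∣p∣ b)}} a≤B ⟩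
      B ℚ.* ∣ b ∣          <⟨ ℚ.*-monoʳ-<-pos B b< ⟩
      B ℚ.* shrink B ε     ≡⟨ sym (ℚ.*-assoc B _ ε) ⟩
      B ℚ.* _ ℚ.* ε        ≡⟨ cong (ℚ._* ε) (ℚ.*-inverseʳ B {{ℚ.pos⇒nonZero B}}) ⟩
      1ℚ ℚ.* ε             ≡⟨ ℚ.*-identityˡ ε ⟩
      ε                    ∎

    plus< : ∀ {ε} a b c d → ∣ a ℚ.- c ∣ ℚ.< half ε → ∣ b ℚ.- d ∣ ℚ.< half ε →
            ∣ (a ℚ.+ b) ℚ.- (c ℚ.+ d) ∣ ℚ.< ε
    plus< a b c d = sum< _ (a ℚ.- c) (b ℚ.- d)
      (solve 4 (λ a b c d → (a :+ b) :- (c :+ d) := (a :- c) :+ (b :- d)) refl a b c d)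

    trans< : ∀ {ε} a b c → ∣ a ℚ.- b ∣ ℚ.< half ε → ∣ b ℚ.- c ∣ ℚ.< half ε →
             ∣ a ℚ.- c ∣ ℚ.< ε
    trans< a b c = sum< _ (a ℚ.- b) (b ℚ.- c)
      (solve 3 (λ a b c → a :- c := (a :- b) :+ (b :- c)) refl a b c)

    neg< : ∀ {ε} a b → ∣ a ℚ.- b ∣ ℚ.< ε → ∣ ℚ.- a ℚ.- ℚ.- b ∣ ℚ.< ε
    neg< {ε} a b = subst (ℚ._< ε) (trans (∣∣-sym a b)
      (cong ∣_∣ (solve 2 (λ a b → b :- a := (:- a) :- (:- b)) refl a b)))

    times< : ∀ A .{{_ : Positive A}} D .{{_ : Positive D}} {ε} a b c d →
             ∣ a ∣ ℚ.≤ A → ∣ d ∣ ℚ.≤ D →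
             ∣ a ℚ.- c ∣ ℚ.< shrink D (half ε) → ∣ b ℚ.- d ∣ ℚ.< shrink A (half ε) →
             ∣ a ℚ.* b ℚ.- c ℚ.* d ∣ ℚ.< ε
    times< A D a b c d a≤A d≤D ac bd = sum< _ (a ℚ.* (b ℚ.- d)) (d ℚ.* (a ℚ.- c))
      (solve 4 (λ a b c d → a :* b :- c :* d := a :* (b :- d) :+ d :* (a :- c)) refl a b c d)
      (prod< A a (b ℚ.- d) a≤A bd) (prod< D d (a ℚ.- c) d≤D ac)

    bounded : (x : ℝ) → ∃ λ B → Positive B ×
              ∃ λ N → ∀ n → N ℕ.≤ n → ∣ seq x n ∣ ℚ.≤ B
    bounded x with cauchy x 1ℚ (ℚ.positive⁻¹ 1ℚ)
    ... | N , h = ∣ c ∣ ℚ.+ 1ℚ , positive B>0 , N , λ n N≤n → begin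
        ∣ seq x n ∣                  ≡⟨ cong ∣_∣ (solve 2 (λ a c → a := c :+ (a :- c)) refl (seq x n) c) ⟩
        ∣ c ℚ.+ (seq x n ℚ.- c) ∣    ≤⟨ ℚ.∣p+q∣≤∣p∣+∣q∣ c (seq x n ℚ.- c) ⟩
        ∣ c ∣ ℚ.+ ∣ seq x n ℚ.- c ∣  ≤⟨ ℚ.+-monoʳ-≤ ∣ c ∣ (ℚ.<⇒≤ (h n N N≤n ℕ.≤-refl)) ⟩
        ∣ c ∣ ℚ.+ 1ℚ                 ∎
      where
      c : ℚ
      c = seq x N
      B>0 : 0ℚ ℚ.< ∣ c ∣ ℚ.+ 1ℚ
      B>0 = ℚ.+-mono-≤-< (ℚ.0≤∣p∣ c) (ℚ.positive⁻¹ 1ℚ)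

    ⊔-left : ∀ {a b n} → a ℕ.⊔ b ℕ.≤ n → a ℕ.≤ n
    ⊔-left {a} {b} = ℕ.m⊔n≤o⇒m≤o a b

    ⊔-right : ∀ {a b n} → a ℕ.⊔ b ℕ.≤ n → b ℕ.≤ n
    ⊔-right {a} {b} = ℕ.m⊔n≤o⇒n≤o a b

    +-cauchy : (x y : ℝ) → IsCauchy (λ i → seq x i ℚ.+ seq y i)
    +-cauchy x y ε ε>0
      with cauchy x (half ε) (half>0 ε>0) | cauchy y (half ε) (half>0 ε>0)
    ... | M , hx | N , hy = M ℕ.⊔ N , λ m n pm pn →
      plus< (seq x m) (seq y m) (seq x n) (seq y n)
        (hx m n (⊔-left pm) (⊔-left pn))
        (hy m n (⊔-right {M} pm) (⊔-right {M} pn))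

    neg-cauchy : (x : ℝ) → IsCauchy (λ i → ℚ.- seq x i)
    neg-cauchy x ε ε>0 with cauchy x ε ε>0
    ... | N , h = N , λ m n pm pn → neg< (seq x m) (seq x n) (h m n pm pn)

    *-cauchy : (x y : ℝ) → IsCauchy (λ i → seq x i ℚ.* seq y i)
    *-cauchy x y ε ε>0 =
      let A , A>0 , K , bx = bounded x
          D , D>0 , L , by = bounded y
          M , hx = cauchy x (shrink D {{D>0}} (half ε)) (shrink>0 D {{D>0}} (half>0 ε>0))
          N , hy = cauchy y (shrink A {{A>0}} (half ε)) (shrink>0 A {{A>0}} (half>0 ε>0))
      in (K ℕ.⊔ L) ℕ.⊔ (M ℕ.⊔ N) , λ m n pm pn →
        times< A {{A>0}} D {{D>0}} (seq x m) (seq y m) (seq x n) (seq y n)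
          (bx m (⊔-left {K} {L} (⊔-left pm))) (by n (⊔-right {K} {L} (⊔-left pn)))
          (hx m n (⊔-left {M} {N} (⊔-right {K ℕ.⊔ L} pm)) (⊔-left {M} {N} (⊔-right {K ℕ.⊔ L} pn)))
          (hy m n (⊔-right {M} {N} (⊔-right {K ℕ.⊔ L} pm)) (⊔-right {M} {N} (⊔-right {K ℕ.⊔ L} pn)))

infixl 6 _+_ _-_
infixl 7 _*_ _/_
infix  8 -_

fromℚ : ℚ → ℝ
fromℚ p = mkℝ (λ _ → p) λ ε ε>0 → 0 , λ _ _ _ _ → ∣0∣<ε (ℚ.+-inverseʳ p) ε>0

fromℕ : ℕ → ℝ
fromℕ n = fromℚ (+ n ℚ./ 1)

_+_ _*_ : ℝ → ℝ → ℝ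
x + y = mkℝ (λ i → seq x i ℚ.+ seq y i) (+-cauchy x y)
x * y = mkℝ (λ i → seq x i ℚ.* seq y i) (*-cauchy x y)

-_ : ℝ → ℝ
- x = mkℝ (λ i → ℚ.- seq x i) (neg-cauchy x)

_-_ : ℝ → ℝ → ℝ
x - y = x + - y

-- Division of a real by a positive integer; see /-cancel.
_/_ : ℝ → (m : ℕ) .{{_ : NonZero m}} → ℝ
x / m = fromℚ (+ 1 ℚ./ m) * x

pointwise : ∀ {x y} → (∀ i → seq x i ≡ seq y i) → x ≃ y
pointwise {x} {y} eq = mk≃ λ ε ε>0 → 0 , λ n _ →
  ∣0∣<ε (trans (cong (ℚ._- seq y n) (eq n)) (ℚ.+-inverseʳ (seq y n))) ε>0

≃-refl : ∀ {x} → x ≃ x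
≃-refl = pointwise λ _ → refl

≃-sym : ∀ {x y} → x ≃ y → y ≃ x
≃-sym {x} {y} p = mk≃ λ ε ε>0 → let N , h = close p ε ε>0 in
  N , λ n N≤n → subst (ℚ._< ε) (∣∣-sym (seq x n) (seq y n)) (h n N≤n)

≃-trans : ∀ {x y z} → x ≃ y → y ≃ z → x ≃ z
≃-trans {x} {y} {z} p q = mk≃ λ ε ε>0 →
  let M , h = close p (half ε) (half>0 ε>0)
      N , g = close q (half ε) (half>0 ε>0)
  in M ℕ.⊔ N , λ n le → trans< (seq x n) (seq y n) (seq z n)
       (h n (⊔-left le)) (g n (⊔-right {M} le))

+-cong : ∀ {x y u v} → x ≃ y → u ≃ v → x + u ≃ y + v
+-cong {x} {y} {u} {v} p q = mk≃ λ ε ε>0 →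
  let M , h = close p (half ε) (half>0 ε>0)
      N , g = close q (half ε) (half>0 ε>0)
  in M ℕ.⊔ N , λ n le → plus< (seq x n) (seq u n) (seq y n) (seq v n)
       (h n (⊔-left le)) (g n (⊔-right {M} le))

-‿cong : ∀ {x y} → x ≃ y → - x ≃ - y
-‿cong {x} {y} p = mk≃ λ ε ε>0 → let N , h = close p ε ε>0 in
  N , λ n le → neg< (seq x n) (seq y n) (h n le)

*-cong : ∀ {x y u v} → x ≃ y → u ≃ v → x * u ≃ y * v
*-cong {x} {y} {u} {v} p q = mk≃ λ ε ε>0 →
  let A , A>0 , K , bx = bounded x
      D , D>0 , L , bv = bounded v
      M , h = close p (shrink D {{D>0}} (half ε)) (shrink>0 D {{D>0}} (half>0 ε>0))
      N , g = close q (shrink A {{A>0}} (half ε)) (shrink>0 A {{A>0}} (half>0 ε>0))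
  in (K ℕ.⊔ L) ℕ.⊔ (M ℕ.⊔ N) , λ n le →
       times< A {{A>0}} D {{D>0}} (seq x n) (seq u n) (seq y n) (seq v n)
         (bx n (⊔-left {K} {L} (⊔-left le))) (bv n (⊔-right {K} {L} (⊔-left le)))
         (h n (⊔-left {M} {N} (⊔-right {K ℕ.⊔ L} le)))
         (g n (⊔-right {M} {N} (⊔-right {K ℕ.⊔ L} le)))

+-assoc : ∀ x y z → (x + y) + z ≃ x + (y + z)
+-assoc x y z = pointwise λ i → ℚ.+-assoc (seq x i) (seq y i) (seq z i)

+-comm : ∀ x y → x + y ≃ y + x
+-comm x y = pointwise λ i → ℚ.+-comm (seq x i) (seq y i)

+-identityˡ : ∀ x → fromℕ 0 + x ≃ x
+-identityˡ x = pointwise λ i → ℚ.+-identityˡ (seq x i)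

-‿inverseˡ : ∀ x → - x + x ≃ fromℕ 0
-‿inverseˡ x = pointwise λ i → ℚ.+-inverseˡ (seq x i)

*-assoc : ∀ x y z → (x * y) * z ≃ x * (y * z)
*-assoc x y z = pointwise λ i → ℚ.*-assoc (seq x i) (seq y i) (seq z i)

*-comm : ∀ x y → x * y ≃ y * x
*-comm x y = pointwise λ i → ℚ.*-comm (seq x i) (seq y i)

*-identityˡ : ∀ x → fromℕ 1 * x ≃ x
*-identityˡ x = pointwise λ i → ℚ.*-identityˡ (seq x i)

*-distribʳ-+ : ∀ x y z → (y + z) * x ≃ y * x + z * x
*-distribʳ-+ x y z = pointwise λ i → ℚ.*-distribʳ-+ (seq x i) (seq y i) (seq z i)

≃-setoid : Setoid 0ℓ 0ℓ
≃-setoid = record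
  { Carrier = ℝ ; _≈_ = _≃_
  ; isEquivalence = record { refl = ≃-refl ; sym = ≃-sym ; trans = ≃-trans } }

ℝ-commutativeRing : CommutativeRing 0ℓ 0ℓ
ℝ-commutativeRing = record
  { Carrier = ℝ ; _≈_ = _≃_ ; _+_ = _+_ ; _*_ = _*_ ; -_ = -_
  ; 0# = fromℕ 0 ; 1# = fromℕ 1
  ; isCommutativeRing = record
    { isRing = record
      { +-isAbelianGroup = record
        { isGroup = record
          { isMonoid = record
            { isSemigroup = record
              { isMagma = record { isEquivalence = Setoid.isEquivalence ≃-setoid ; ∙-cong = +-cong }
              ; assoc = +-assoc }
            ; identity = comm∧idˡ⇒id +-comm +-identityˡ }
          ; inverse = comm∧invˡ⇒inv +-comm -‿inverseˡ
          ; ⁻¹-cong = -‿cong }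
        ; comm = +-comm }
      ; *-cong = *-cong
      ; *-assoc = *-assoc
      ; *-identity = comm∧idˡ⇒id *-comm *-identityˡ
      ; distrib = comm∧distrʳ⇒distr +-cong *-comm *-distribʳ-+ }
    ; *-comm = *-comm } }
  where open Consequences ≃-setoid

/-cancel : ∀ x m .{{_ : NonZero m}} → fromℕ m * (x / m) ≃ x
/-cancel x m@(suc d) = pointwise λ i → begin-equality
  (+ m ℚ./ 1) ℚ.* ((+ 1 ℚ./ m) ℚ.* seq x i)   ≡⟨ sym (ℚ.*-assoc (+ m ℚ./ 1) (+ 1 ℚ./ m) (seq x i)) ⟩
  (+ m ℚ./ 1) ℚ.* (+ 1 ℚ./ m) ℚ.* seq x i     ≡⟨ cong (ℚ._* seq x i) m*1/m ⟩
  1ℚ ℚ.* seq x i                              ≡⟨ ℚ.*-identityˡ (seq x i) ⟩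
  seq x i                                     ∎
  where
  m*1/m : (+ m ℚ./ 1) ℚ.* (+ 1 ℚ./ m) ≡ 1ℚ
  m*1/m = ℚ.toℚᵘ-injective (ℚᵘ.≃-trans
    (ℚ.toℚᵘ-homo-* (+ m ℚ./ 1) (+ 1 ℚ./ m))
    (ℚᵘ.≃-trans
      (ℚᵘ.*-cong (ℚ.toℚᵘ-fromℚᵘ (ℚᵘ.mkℚᵘ (+ m) 0)) (ℚ.toℚᵘ-fromℚᵘ (ℚᵘ.mkℚᵘ (+ 1) d)))
      (ℚᵘ.*-inverseʳ (ℚᵘ.mkℚᵘ (+ m) 0))))

-- (x)_{m,lam} = x (x - lam) ⋯ (x - (m-1) lam)
falling : ℝ → ℝ → ℕ → ℝ
falling lam x zero    = fromℕ 1
falling lam x (suc m) = falling lam x m * (x - fromℕ m * lam)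

-- The sum of f j over 1 ≤ j ≤ n; the index starts at 1, and n = 0 gives 0.
sumTo : ℕ → (ℕ → ℝ) → ℝ
sumTo zero    f = fromℕ 0
sumTo (suc n) f = sumTo n f + f (suc n)

syntax sumTo n (λ j → e) = ∑[1≤ j ≤ n ] e

S : ℝ → ℕ → ℕ → ℝ
S lam r n = ∑[1≤ j ≤ n ] falling lam (fromℕ j) r

{-# OPTIONS --safe #-}
module Submission where

open import Data.Nat.Base as ℕ using (ℕ; zero; suc; NonZero; _∸_)
open import Data.Nat.Combinatorics using (_C_)
open import Defs
open import Algebra.Solver.Ring.AlmostCommutativeRing using (AlmostCommutativeRing; fromCommutativeRing; _-Raw-AlmostCommutative⟶_)
import Algebra.Solver.Ring as RingSolver
open import Data.Integer.Base as ℤ using (+_)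
import Data.Integer.Properties as ℤ
open import Data.Maybe.Base as Maybe using (Maybe)
open import Data.Nat.Combinatorics using (nCn≡1; nC1≡n; nCk≡nC[n∸k]; nCk+nC[k+1]≡[n+1]C[k+1]; k>n⇒nCk≡0)
import Data.Nat.Properties as ℕ
open import Data.Rational.Base as ℚ using (ℚ; 0ℚ; 1ℚ)
import Data.Rational.Properties as ℚ
import Data.Rational.Unnormalised.Base as ℚᵘ
import Data.Rational.Unnormalised.Properties as ℚᵘ
open import Relation.Binary.PropositionalEquality using (_≡_; refl; sym; trans; cong; cong₂)
import Relation.Binary.Reasoning.Setoid ≃-setoid as ≃-Reasoning
open import Relation.Nullary.Decidable using (dec⇒maybe)

-- Summing j (j+1)_k − (j−1) (j)_k over 1 ≤ j ≤ n telescopes to n (n+1)_k, and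
-- the summand is (j)_k + j ((j+1)_k − (j)_k).  The Vandermonde identity expands
-- (j+1)_k = Σ_r C(k,r) (1)_{k−r} (j)_r, and j (j)_r = (j)_{r+1} + r λ (j)_r turns
-- the product with j into a combination of falling factorials of j again.  Its
-- terms in (j)_k, together with the extra (j)_k, add up to (k+1) (j)_k.

-- Ring solving over the reals with rational constants.

private
  ℝ-ring : AlmostCommutativeRing _ _
  ℝ-ring = fromCommutativeRing ℝ-commutativeRing

  -- Constants are taken from `ℚ` because equality is decidable there. `fromℕ 0` and `fromℕ 1`
  -- compute to `fromℚ 0ℚ` and `fromℚ 1ℚ`, so `con 0ℚ` and `con 1ℚ` denote them in solver goals.
  fromℚ-homomorphism : ℚ.+-*-rawRing -Raw-AlmostCommutative⟶ ℝ-ring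
  fromℚ-homomorphism = record
    { ⟦_⟧    = fromℚ
    ; +-homo = λ _ _ → pointwise λ _ → refl
    ; *-homo = λ _ _ → pointwise λ _ → refl
    ; -‿homo = λ _ → pointwise λ _ → refl
    ; 0-homo = ≃-refl
    ; 1-homo = ≃-refl
    }

  fromℚ-≟ : ∀ p q → Maybe (fromℚ p ≃ fromℚ q)
  fromℚ-≟ p q = Maybe.map (λ p≡q → pointwise λ _ → p≡q) (dec⇒maybe (p ℚ.≟ q))

open RingSolver ℚ.+-*-rawRing ℝ-ring fromℚ-homomorphism fromℚ-≟
  using (solve; con; _:+_; _:*_; _:-_; _:=_)

-- Natural numbers as reals, falling factorials and boundary binomials.

fromℕ-≡ : ∀ {m n} → m ≡ n → fromℕ m ≃ fromℕ n
fromℕ-≡ refl = ≃-refl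

-- `+ n ℚ./ 1` normalises through a gcd, which is stuck for a variable `n`. In unnormalised
-- rationals all denominators are 1 and an integer identity remains.
fromℕ-+ : ∀ m n → fromℕ (m ℕ.+ n) ≃ fromℕ m + fromℕ n
fromℕ-+ m n = pointwise λ _ → ℚ.toℚᵘ-injective (begin
  ℚ.toℚᵘ (+ (m ℕ.+ n) ℚ./ 1)                   ≈⟨ ℚ.toℚᵘ-fromℚᵘ (ℚᵘ.mkℚᵘ (+ (m ℕ.+ n)) 0) ⟩
  ℚᵘ.mkℚᵘ (+ (m ℕ.+ n)) 0                      ≈⟨ ℚᵘ.*≡* (cong (ℤ._* + 1) (sym (cong₂ ℤ._+_ (ℤ.*-identityʳ (+ m)) (ℤ.*-identityʳ (+ n))))) ⟩
  ℚᵘ.mkℚᵘ (+ m) 0 ℚᵘ.+ ℚᵘ.mkℚᵘ (+ n) 0         ≈⟨ ℚᵘ.+-cong (ℚ.toℚᵘ-fromℚᵘ (ℚᵘ.mkℚᵘ (+ m) 0)) (ℚ.toℚᵘ-fromℚᵘ (ℚᵘ.mkℚᵘ (+ n) 0)) ⟨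
  ℚ.toℚᵘ (+ m ℚ./ 1) ℚᵘ.+ ℚ.toℚᵘ (+ n ℚ./ 1)   ≈⟨ ℚ.toℚᵘ-homo-+ (+ m ℚ./ 1) (+ n ℚ./ 1) ⟨
  ℚ.toℚᵘ ((+ m ℚ./ 1) ℚ.+ (+ n ℚ./ 1))         ∎)
  where
  open ℚᵘ.≃-Reasoning

fromℕ-suc : ∀ n → fromℕ (suc n) ≃ fromℕ n + fromℕ 1
fromℕ-suc n = ≃-trans (fromℕ-+ 1 n) (+-comm (fromℕ 1) (fromℕ n))

falling-cong : ∀ lam {x y} m → x ≃ y → falling lam x m ≃ falling lam y m
falling-cong lam zero    x≃y = ≃-refl
falling-cong lam (suc m) x≃y = *-cong (falling-cong lam m x≃y) (+-cong x≃y ≃-refl)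

nC0≡1 : ∀ n → n C 0 ≡ 1
nC0≡1 n = trans (nCk≡nC[n∸k] (ℕ.z≤n {n})) (nCn≡1 n)

[n+1]Cn≡n+1 : ∀ n → suc n C n ≡ suc n
[n+1]Cn≡n+1 n = trans (nCk≡nC[n∸k] (ℕ.n≤1+n n))
  (trans (cong (suc n C_) (ℕ.m+n∸n≡m 1 n)) (nC1≡n (suc n)))

-- Finite sums.

-- The hypothesis receives the bound on the index because identities about `k ∸ r` often hold only
-- for r ≤ k.
sumTo-cong : ∀ {f g} n → (∀ i → i ℕ.< n → f (suc i) ≃ g (suc i)) → sumTo n f ≃ sumTo n g
sumTo-cong zero    f≃g = ≃-refl
sumTo-cong (suc n) f≃g =
  +-cong (sumTo-cong n λ i i<n → f≃g i (ℕ.m<n⇒m<1+n i<n)) (f≃g n ℕ.≤-refl)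

sumTo-+ : ∀ f g n → sumTo n (λ r → f r + g r) ≃ sumTo n f + sumTo n g
sumTo-+ f g zero    = solve 0 (con 0ℚ := con 0ℚ :+ con 0ℚ) ≃-refl
sumTo-+ f g (suc n) = ≃-trans (+-cong (sumTo-+ f g n) ≃-refl)
  (solve 4 (λ F G a b → F :+ G :+ (a :+ b) := F :+ a :+ (G :+ b)) ≃-refl
    (sumTo n f) (sumTo n g) (f (suc n)) (g (suc n)))

sumTo-*ˡ : ∀ c f n → sumTo n (λ r → c * f r) ≃ c * sumTo n f
sumTo-*ˡ c f zero    = solve 1 (λ c → con 0ℚ := c :* con 0ℚ) ≃-refl c
sumTo-*ˡ c f (suc n) = ≃-trans (+-cong (sumTo-*ˡ c f n) ≃-refl)
  (solve 3 (λ c F a → c :* F :+ c :* a := c :* (F :+ a)) ≃-refl c (sumTo n f) (f (suc n)))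

sumTo-zero : ∀ {f} n → (∀ r → f r ≃ fromℕ 0) → sumTo n f ≃ fromℕ 0
sumTo-zero zero    f≃0 = ≃-refl
sumTo-zero (suc n) f≃0 = ≃-trans (+-cong (sumTo-zero n f≃0) (f≃0 (suc n))) (+-identityˡ (fromℕ 0))

-- As r runs from 1 to n+1, `r ∸ 1` runs from 0 to n, so this turns a sum that starts at 0 into one
-- that starts at 1.
sumTo-shift : ∀ f n → sumTo (suc n) (λ r → f (r ∸ 1)) ≃ f 0 + sumTo n f
sumTo-shift f zero    = +-comm (fromℕ 0) (f 0)
sumTo-shift f (suc n) = ≃-trans (+-cong (sumTo-shift f n) ≃-refl) (+-assoc (f 0) (sumTo n f) (f (suc n)))

-- Binomial sums.

binomialTerm : ℕ → (ℕ → ℕ → ℝ) → ℕ → ℝ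
binomialTerm k t r = fromℕ (k C r) * t r (k ∸ r)

-- The term r = 0 stands apart because `sumTo` starts at 1. The summand takes r and s = k - r
-- separately, so that a recursion can raise either one.
binomialSum : ℕ → (ℕ → ℕ → ℝ) → ℝ
binomialSum k t = binomialTerm k t 0 + sumTo k (binomialTerm k t)

binomialSum-cong : ∀ {t u} k → (∀ r s → r ℕ.+ s ≡ k → t r s ≃ u r s) →
                   binomialSum k t ≃ binomialSum k u
binomialSum-cong k t≃u = +-cong (*-cong ≃-refl (t≃u 0 k refl))
  (sumTo-cong k λ i i<k → *-cong ≃-refl (t≃u (suc i) (k ∸ suc i) (ℕ.m+[n∸m]≡n i<k)))

binomialSum-+ : ∀ t u k →
  binomialSum k (λ r s → t r s + u r s) ≃ binomialSum k t + binomialSum k u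
binomialSum-+ t u k = begin
  binomialTerm k (λ r s → t r s + u r s) 0 + sumTo k (binomialTerm k (λ r s → t r s + u r s))
    ≈⟨ +-cong (distrib 0) (sumTo-cong k λ i _ → distrib (suc i)) ⟩
  (T 0 + U 0) + sumTo k (λ r → T r + U r)
    ≈⟨ +-cong ≃-refl (sumTo-+ T U k) ⟩
  (T 0 + U 0) + (sumTo k T + sumTo k U)
    ≈⟨ solve 4 (λ a b c d → (a :+ b) :+ (c :+ d) := (a :+ c) :+ (b :+ d)) ≃-refl
         (T 0) (U 0) (sumTo k T) (sumTo k U) ⟩
  binomialSum k t + binomialSum k u ∎
  where
  open ≃-Reasoning
  T U : ℕ → ℝ
  T = binomialTerm k t
  U = binomialTerm k u
  distrib : ∀ r → binomialTerm k (λ r s → t r s + u r s) r ≃ T r + U r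
  distrib r = solve 3 (λ c a b → c :* (a :+ b) := c :* a :+ c :* b) ≃-refl
    (fromℕ (k C r)) (t r (k ∸ r)) (u r (k ∸ r))

binomialSum-*ˡ : ∀ c t k → binomialSum k (λ r s → c * t r s) ≃ c * binomialSum k t
binomialSum-*ˡ c t k = begin
  binomialTerm k (λ r s → c * t r s) 0 + sumTo k (binomialTerm k (λ r s → c * t r s))
    ≈⟨ +-cong (swap 0) (sumTo-cong k λ i _ → swap (suc i)) ⟩
  c * T 0 + sumTo k (λ r → c * T r)
    ≈⟨ +-cong ≃-refl (sumTo-*ˡ c T k) ⟩
  c * T 0 + c * sumTo k T
    ≈⟨ solve 3 (λ c a b → c :* a :+ c :* b := c :* (a :+ b)) ≃-refl c (T 0) (sumTo k T) ⟩
  c * binomialSum k t ∎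
  where
  open ≃-Reasoning
  T : ℕ → ℝ
  T = binomialTerm k t
  swap : ∀ r → binomialTerm k (λ r s → c * t r s) r ≃ c * T r
  swap r = solve 3 (λ b c a → b :* (c :* a) := c :* (b :* a)) ≃-refl
    (fromℕ (k C r)) c (t r (k ∸ r))

-- Pascal's rule splits C(k+1,r) into C(k,r-1) + C(k,r); re-indexing the first part raises r in the
-- summand, while the second raises s.
binomialSum-suc : ∀ t k →
  binomialSum (suc k) t
    ≃ binomialSum k (λ r s → t (suc r) s) + binomialSum k (λ r s → t r (suc s))
binomialSum-suc t k = begin
  binomialTerm (suc k) t 0 + sumTo (suc k) (binomialTerm (suc k) t)
    ≈⟨ +-cong (*-cong (fromℕ-≡ (trans (nC0≡1 (suc k)) (sym (nC0≡1 k)))) ≃-refl)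
         (sumTo-cong (suc k) λ i _ → pascal i) ⟩
  V 0 + sumTo (suc k) (λ r → U (r ∸ 1) + V′ r)
    ≈⟨ +-cong ≃-refl (sumTo-+ (λ r → U (r ∸ 1)) V′ (suc k)) ⟩
  V 0 + (sumTo (suc k) (λ r → U (r ∸ 1)) + (sumTo k V′ + V′ (suc k)))
    ≈⟨ +-cong ≃-refl (+-cong (sumTo-shift U k) (+-cong V′≃V V′[k+1]≃0)) ⟩
  V 0 + ((U 0 + sumTo k U) + (sumTo k V + fromℕ 0))
    ≈⟨ solve 3 (λ a b c → a :+ (b :+ (c :+ con 0ℚ)) := b :+ (a :+ c)) ≃-refl
         (V 0) (U 0 + sumTo k U) (sumTo k V) ⟩
  (U 0 + sumTo k U) + (V 0 + sumTo k V) ∎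
  where
  open ≃-Reasoning
  U V V′ : ℕ → ℝ
  U = binomialTerm k (λ r s → t (suc r) s)
  V = binomialTerm k (λ r s → t r (suc s))
  -- `V′` agrees with `V` for r ≤ k, where `suc k ∸ r` equals `suc (k ∸ r)`. At r = k+1 they may
  -- differ in the summand, but C(k,k+1) = 0 removes the term.
  V′ r = fromℕ (k C r) * t r (suc k ∸ r)
  pascal : ∀ i → binomialTerm (suc k) t (suc i) ≃ U i + V′ (suc i)
  pascal i = begin
    fromℕ (suc k C suc i) * x
      ≈⟨ *-cong (fromℕ-≡ (nCk+nC[k+1]≡[n+1]C[k+1] k i)) ≃-refl ⟨
    fromℕ (k C i ℕ.+ k C suc i) * x
      ≈⟨ *-cong (fromℕ-+ (k C i) (k C suc i)) ≃-refl ⟩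
    (fromℕ (k C i) + fromℕ (k C suc i)) * x
      ≈⟨ *-distribʳ-+ x (fromℕ (k C i)) (fromℕ (k C suc i)) ⟩
    fromℕ (k C i) * x + fromℕ (k C suc i) * x ∎
    where
    x : ℝ
    x = t (suc i) (k ∸ i)
  V′≃V : sumTo k V′ ≃ sumTo k V
  V′≃V = sumTo-cong k λ i i<k → *-cong ≃-refl (t-cong (suc i) (ℕ.+-∸-assoc 1 i<k))
    where
    t-cong : ∀ r {s s′} → s ≡ s′ → t r s ≃ t r s′
    t-cong r refl = ≃-refl
  V′[k+1]≃0 : V′ (suc k) ≃ fromℕ 0
  V′[k+1]≃0 = ≃-trans (*-cong (fromℕ-≡ (k>n⇒nCk≡0 (ℕ.n<1+n k))) ≃-refl)
    (solve 1 (λ x → con 0ℚ :* x := con 0ℚ) ≃-refl (t (suc k) (k ∸ k)))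

-- The degenerate Vandermonde identity.

-- Induction on k: in each term with r + s = k, the new factor x + y - kλ extends either (x)_r or
-- (y)_s by one factor, and `binomialSum-suc` collects the two resulting sums.
falling-vandermonde : ∀ lam x y k →
  falling lam (x + y) k ≃ binomialSum k (λ r s → falling lam y s * falling lam x r)
falling-vandermonde lam x y zero =
  solve 0 (con 1ℚ := con 1ℚ :* (con 1ℚ :* con 1ℚ) :+ con 0ℚ) ≃-refl
falling-vandermonde lam x y (suc k) = begin
  falling lam (x + y) k * z
    ≈⟨ *-cong (falling-vandermonde lam x y k) ≃-refl ⟩
  binomialSum k (λ r s → Y s * X r) * z
    ≈⟨ *-comm (binomialSum k (λ r s → Y s * X r)) z ⟩
  z * binomialSum k (λ r s → Y s * X r)
    ≈⟨ binomialSum-*ˡ z (λ r s → Y s * X r) k ⟨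
  binomialSum k (λ r s → z * (Y s * X r))
    ≈⟨ binomialSum-cong k split ⟩
  binomialSum k (λ r s → Y s * X (suc r) + Y (suc s) * X r)
    ≈⟨ binomialSum-+ (λ r s → Y s * X (suc r)) (λ r s → Y (suc s) * X r) k ⟩
  binomialSum k (λ r s → Y s * X (suc r)) + binomialSum k (λ r s → Y (suc s) * X r)
    ≈⟨ binomialSum-suc (λ r s → Y s * X r) k ⟨
  binomialSum (suc k) (λ r s → Y s * X r) ∎
  where
  open ≃-Reasoning
  X Y : ℕ → ℝ
  X = falling lam x
  Y = falling lam y
  z : ℝ
  z = x + y - fromℕ k * lam
  -- x + y − (r+s) λ = (x − r λ) + (y − s λ)
  split : ∀ r s → r ℕ.+ s ≡ k → z * (Y s * X r) ≃ Y s * X (suc r) + Y (suc s) * X r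
  split r s refl = ≃-trans
    (*-cong (+-cong ≃-refl (-‿cong (*-cong (fromℕ-+ r s) ≃-refl))) ≃-refl)
    (solve 7 (λ x y r s l Ys Xr → (x :+ y :- (r :+ s) :* l) :* (Ys :* Xr)
        := Ys :* (Xr :* (x :- r :* l)) :+ Ys :* (y :- s :* l) :* Xr) ≃-refl
      x y (fromℕ r) (fromℕ s) lam (Y s) (X r))

-- Multiplying the expansion of (x+1)_k by x.

-- The coefficients of S_r in the two sums of the theorem.
shiftCoeff weightCoeff : ℝ → ℕ → ℕ → ℝ
shiftCoeff  lam k r = falling lam (fromℕ 1) (suc k ∸ r) * fromℕ (k C (r ∸ 1))
weightCoeff lam k r = fromℕ r * fromℕ (k C r) * falling lam (fromℕ 1) (k ∸ r)

-- Vandermonde with y = 1. Terms below r = k are rewritten by `xT`; the raised term from r = k-1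
-- supplies the k copies of (x)_k.
x*falling[x+1] : ∀ lam x p → let k = suc p in
  x * falling lam (x + fromℕ 1) k
    ≃ (x + fromℕ k) * falling lam x k
      + (sumTo p (λ r → shiftCoeff lam k r * falling lam x r)
        + lam * sumTo p (λ r → weightCoeff lam k r * falling lam x r))
x*falling[x+1] lam x p = begin
  x * falling lam (x + fromℕ 1) k
    ≈⟨ *-cong ≃-refl (falling-vandermonde lam x (fromℕ 1) k) ⟩
  x * (T 0 + (sumTo p T + T k))
    -- The term r = k stays as x (x)_k; raising it would bring in (x)_{k+1}.
    ≈⟨ solve 4 (λ x a b c → x :* (a :+ (b :+ c)) := x :* c :+ (x :* a :+ x :* b)) ≃-refl
         x (T 0) (sumTo p T) (T k) ⟩
  x * T k + (x * T 0 + x * sumTo p T)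
    ≈⟨ +-cong (*-cong ≃-refl Tk) (+-cong (xT 0) lower) ⟩
  x * X k + ((H 0 + lam * B 0) + (sumTo p H + lam * sumTo p B))
    ≈⟨ solve 6 (λ a h l b hs bs → a :+ ((h :+ l :* b) :+ (hs :+ l :* bs))
                    := a :+ ((h :+ hs) :+ l :* (b :+ bs))) ≃-refl
         (x * X k) (H 0) lam (B 0) (sumTo p H) (sumTo p B) ⟩
  x * X k + ((H 0 + sumTo p H) + lam * (B 0 + sumTo p B))
    -- The weight r vanishes at r = 0, so the λ-sum effectively starts at 1.
    ≈⟨ +-cong ≃-refl (+-cong H-sum (*-cong ≃-refl (+-cong B0 ≃-refl))) ⟩
  x * X k + ((sumTo p A + fromℕ k * X k) + lam * (fromℕ 0 + sumTo p B))
    ≈⟨ solve 6 (λ x K Xk A l B → x :* Xk :+ ((A :+ K :* Xk) :+ l :* (con 0ℚ :+ B))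
                    := (x :+ K) :* Xk :+ (A :+ l :* B)) ≃-refl
         x (fromℕ k) (X k) (sumTo p A) lam (sumTo p B) ⟩
  (x + fromℕ k) * X k + (sumTo p A + lam * sumTo p B) ∎
  where
  open ≃-Reasoning
  k : ℕ
  k = suc p
  X I A B T H : ℕ → ℝ
  X = falling lam x
  I = falling lam (fromℕ 1)
  A r = shiftCoeff lam k r * X r
  B r = weightCoeff lam k r * X r
  T = binomialTerm k (λ r s → I s * X r)
  H r = I (k ∸ r) * fromℕ (k C r) * X (suc r)
  I-cong : ∀ {s s′} → s ≡ s′ → I s ≃ I s′
  I-cong refl = ≃-refl
  Tk : T k ≃ X k
  Tk = ≃-trans (*-cong (fromℕ-≡ (nCn≡1 k)) (*-cong (I-cong (ℕ.n∸n≡0 k)) ≃-refl))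
    (solve 1 (λ a → con 1ℚ :* (con 1ℚ :* a) := a) ≃-refl (X k))
  -- x (x)_r = (x)_{r+1} + r λ (x)_r
  xT : ∀ r → x * T r ≃ H r + lam * B r
  xT r = solve 6 (λ x c i Xr r l → x :* (c :* (i :* Xr))
      := i :* c :* (Xr :* (x :- r :* l)) :+ l :* (r :* c :* i :* Xr)) ≃-refl
    x (fromℕ (k C r)) (I (k ∸ r)) (X r) (fromℕ r) lam
  lower : x * sumTo p T ≃ sumTo p H + lam * sumTo p B
  lower = begin
    x * sumTo p T                         ≈⟨ sumTo-*ˡ x T p ⟨
    sumTo p (λ r → x * T r)               ≈⟨ sumTo-cong p (λ i _ → xT (suc i)) ⟩
    sumTo p (λ r → H r + lam * B r)       ≈⟨ sumTo-+ H (λ r → lam * B r) p ⟩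
    sumTo p H + sumTo p (λ r → lam * B r) ≈⟨ +-cong ≃-refl (sumTo-*ˡ lam B p) ⟩
    sumTo p H + lam * sumTo p B           ∎
  B0 : B 0 ≃ fromℕ 0
  B0 = solve 3 (λ c i a → con 0ℚ :* c :* i :* a := con 0ℚ) ≃-refl (fromℕ (k C 0)) (I k) (X 0)
  Hp : H p ≃ fromℕ k * X k
  Hp = ≃-trans
    (*-cong (*-cong (I-cong (ℕ.m+n∸n≡m 1 p)) (fromℕ-≡ ([n+1]Cn≡n+1 p))) ≃-refl)
    (solve 3 (λ l K a → con 1ℚ :* (con 1ℚ :- con 0ℚ :* l) :* K :* a := K :* a) ≃-refl
      lam (fromℕ k) (X k))
  H-sum : H 0 + sumTo p H ≃ sumTo p A + fromℕ k * X k
  H-sum = begin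
    H 0 + sumTo p H                   ≈⟨ sumTo-shift H p ⟨
    -- For r ≥ 1, `H (r ∸ 1)` is `A r` by computation. The last term has coefficient (1)_1 C(k,k-1)
    -- = k.
    sumTo p (λ r → H (r ∸ 1)) + H p   ≈⟨ +-cong (sumTo-cong p λ i _ → ≃-refl) Hp ⟩
    sumTo p A + fromℕ k * X k         ∎

-- Telescoping over j.

-- Induction on n, adding `x*falling[x+1]` at x = n+1 in each step. This is the telescoping sum in
-- recursive form.
n*falling[n+1] : ∀ lam n p → let k = suc p in
  fromℕ n * falling lam (fromℕ (suc n)) k
    ≃ fromℕ (suc k) * S lam k n
      + (sumTo p (λ r → shiftCoeff lam k r * S lam r n)
        + lam * sumTo p (λ r → weightCoeff lam k r * S lam r n))
n*falling[n+1] lam zero p = begin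
  fromℕ 0 * falling lam (fromℕ 1) k
    ≈⟨ solve 3 (λ a K l → con 0ℚ :* a := K :* con 0ℚ :+ (con 0ℚ :+ l :* con 0ℚ)) ≃-refl
         (falling lam (fromℕ 1) k) (fromℕ (suc k)) lam ⟩
  fromℕ (suc k) * fromℕ 0 + (fromℕ 0 + lam * fromℕ 0)
    ≈⟨ +-cong ≃-refl (+-cong (sumTo-zero p (λ r → x*0 (shiftCoeff lam k r)))
         (*-cong ≃-refl (sumTo-zero p (λ r → x*0 (weightCoeff lam k r))))) ⟨
  fromℕ (suc k) * fromℕ 0
    + (sumTo p (λ r → shiftCoeff lam k r * fromℕ 0)
      + lam * sumTo p (λ r → weightCoeff lam k r * fromℕ 0)) ∎
  where
  open ≃-Reasoning
  k : ℕ
  k = suc p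
  x*0 : ∀ x → x * fromℕ 0 ≃ fromℕ 0
  x*0 = solve 1 (λ x → x :* con 0ℚ := con 0ℚ) ≃-refl
n*falling[n+1] lam (suc n) p = begin
  x * falling lam (fromℕ (suc (suc n))) k
    ≈⟨ *-cong ≃-refl (falling-cong lam k (fromℕ-suc (suc n))) ⟩
  x * falling lam (x + fromℕ 1) k
    ≈⟨ x*falling[x+1] lam x p ⟩
  (x + fromℕ k) * F k + (sumTo p (λ r → α r * F r) + lam * sumTo p (λ r → β r * F r))
    -- Regrouping (n+1) + k as n + (k+1) isolates n (n+1)_k, the left side of the induction
    -- hypothesis, and leaves (k+1) (n+1)_k as the new summand of (k+1) S_k.
    ≈⟨ +-cong (*-cong (+-cong (fromℕ-suc n) ≃-refl) ≃-refl) ≃-refl ⟩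
  (fromℕ n + fromℕ 1 + fromℕ k) * F k + (sumTo p (λ r → α r * F r) + lam * sumTo p (λ r → β r * F r))
    ≈⟨ solve 6 (λ n K Fk A l B → (n :+ con 1ℚ :+ K) :* Fk :+ (A :+ l :* B)
                    := n :* Fk :+ (K :+ con 1ℚ) :* Fk :+ (A :+ l :* B)) ≃-refl
         (fromℕ n) (fromℕ k) (F k) (sumTo p (λ r → α r * F r)) lam (sumTo p (λ r → β r * F r)) ⟩
  fromℕ n * F k + (fromℕ k + fromℕ 1) * F k
      + (sumTo p (λ r → α r * F r) + lam * sumTo p (λ r → β r * F r))
    ≈⟨ +-cong (+-cong (n*falling[n+1] lam n p) (*-cong (≃-sym (fromℕ-suc k)) ≃-refl)) ≃-refl ⟩
  fromℕ (suc k) * Σ k + (sumTo p (λ r → α r * Σ r) + lam * sumTo p (λ r → β r * Σ r))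
      + fromℕ (suc k) * F k
      + (sumTo p (λ r → α r * F r) + lam * sumTo p (λ r → β r * F r))
    ≈⟨ solve 8 (λ K s f A B A′ B′ l → K :* s :+ (A :+ l :* B) :+ K :* f :+ (A′ :+ l :* B′)
                    := K :* (s :+ f) :+ ((A :+ A′) :+ l :* (B :+ B′))) ≃-refl
         (fromℕ (suc k)) (Σ k) (F k)
         (sumTo p (λ r → α r * Σ r)) (sumTo p (λ r → β r * Σ r))
         (sumTo p (λ r → α r * F r)) (sumTo p (λ r → β r * F r)) lam ⟩
  fromℕ (suc k) * (Σ k + F k)
      + ((sumTo p (λ r → α r * Σ r) + sumTo p (λ r → α r * F r))
        + lam * (sumTo p (λ r → β r * Σ r) + sumTo p (λ r → β r * F r)))
    -- `Σ r + F r` is `S lam r (suc n)` by definition of `sumTo`.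
    ≈⟨ +-cong ≃-refl (+-cong (merge α) (*-cong ≃-refl (merge β))) ⟩
  fromℕ (suc k) * (Σ k + F k)
      + (sumTo p (λ r → α r * (Σ r + F r)) + lam * sumTo p (λ r → β r * (Σ r + F r))) ∎
  where
  open ≃-Reasoning
  k : ℕ
  k = suc p
  x : ℝ
  x = fromℕ (suc n)
  F Σ α β : ℕ → ℝ
  F = falling lam x
  Σ r = S lam r n
  α = shiftCoeff lam k
  β = weightCoeff lam k
  merge : ∀ γ → sumTo p (λ r → γ r * Σ r) + sumTo p (λ r → γ r * F r)
              ≃ sumTo p (λ r → γ r * (Σ r + F r))
  merge γ = ≃-trans (≃-sym (sumTo-+ (λ r → γ r * Σ r) (λ r → γ r * F r) p))
    (sumTo-cong p λ i _ → solve 3 (λ c a b → c :* a :+ c :* b := c :* (a :+ b)) ≃-refl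
      (γ (suc i)) (Σ (suc i)) (F (suc i)))

-- Solving for S_k.

theorem3p2 : (lam : ℝ) (n k : ℕ) .{{_ : NonZero n}} .{{_ : NonZero k}} →
    S lam k n ≃
      (fromℕ n * falling lam (fromℕ (suc n)) k) / suc k
      - (fromℕ 1 / suc k)
          * (∑[1≤ r ≤ k ∸ 1 ]
              (falling lam (fromℕ 1) (suc k ∸ r) * fromℕ (k C (r ∸ 1)) * S lam r n))
      - (lam / suc k)
          * (∑[1≤ r ≤ k ∸ 1 ]
              (fromℕ r * fromℕ (k C r) * falling lam (fromℕ 1) (k ∸ r) * S lam r n))
theorem3p2 lam n k@(suc p) = ≃-sym (begin
  -- Each quotient by k+1 unfolds to a product with `c` on the left.
  c * P - c * fromℕ 1 * A - c * lam * B
    ≈⟨ +-cong (+-cong (*-cong ≃-refl (n*falling[n+1] lam n p)) ≃-refl) ≃-refl ⟩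
  c * (fromℕ (suc k) * S lam k n + (A + lam * B)) - c * fromℕ 1 * A - c * lam * B
    -- The `A` and `B` terms cancel, and the remaining product is arranged as `/-cancel` expects it.
    ≈⟨ solve 6 (λ c K s A l B → c :* (K :* s :+ (A :+ l :* B)) :- c :* con 1ℚ :* A :- c :* l :* B
                    := K :* (c :* s)) ≃-refl
         c (fromℕ (suc k)) (S lam k n) A lam B ⟩
  fromℕ (suc k) * (S lam k n / suc k)
    ≈⟨ /-cancel (S lam k n) (suc k) ⟩
  S lam k n ∎)
  where
  open ≃-Reasoning
  c P A B : ℝ
  c = fromℚ (+ 1 ℚ./ suc k)
  P = fromℕ n * falling lam (fromℕ (suc n)) k
  A = sumTo p (λ r → shiftCoeff lam k r * S lam r n)
  B = sumTo p (λ r → weightCoeff lam k r * S lam r n)
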